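{- For every constraint list $C$ and all substitutions $\sigma,\sigma'$: if $\mathsf{unify}(C)=\sigma$ and $\sigma'\models C$, then there exists a substitution $\sigma''$ such that $\sigma'\approx\sigma\circ\sigma''$.
   Context: Types: fix a set of type variables (with decidable equality), ranged over by $\alpha,\beta,\dots$. Types are generated by $\tau ::= \alpha \mid \tau_1 \rightarrow \tau_2$. Free variables of a type (a list): $\mathsf{FTV}(\alpha) = [\alpha]$, $\mathsf{FTV}(\tau\rightarrow\tau') = \mathsf{FTV}(\tau) \mathbin{+\!\!+} \mathsf{FTV}(\tau')$, where $+\!\!+$ is list append. "$\alpha$ occurs in $\tau$" means $\alpha\in\mathsf{FTV}(\tau)$. Constraints: a constraint is a formal equation $\tau \stackrel{\rm e}{=} \tau'$ between types; a constraint list is a finite list of constraints. Substitutions: a substitution $\sigma$ is a finite map (finite partial function) from type variables to types. $\sigma_{\mathbb{E}}$ is the empty finite map and $\{\alpha\mapsto\tau\}$ the map whose only binding sends $\alpha$ to $\tau$. Application: $\sigma(\alpha)=\tau$ if $\langle\alpha,\tau\rangle\in\sigma$, $\sigma(\alpha)=\alpha$ if $\alpha$ is not bound by $\sigma$; $\sigma(\tau_1\rightarrow\tau_2)=\sigma(\tau_1)\rightarrow\sigma(\tau_2)$; $\sigma(\tau_1\stackrel{\rm e}{=}\tau_2) = (\sigma(\tau_1)\stackrel{\rm e}{=}\sigma(\tau_2))$; and $\sigma(C)$ is obtained by applying $\sigma$ to each constraint in the list $C$. Extensional equality: $\sigma\approx\sigma'$ means $\sigma(\alpha)=\sigma'(\alpha)$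 for all type variables $\alpha$. Composition: $\sigma\circ\sigma'$ is the finite map that binds $\alpha$ to $\sigma'(\tau)$ if $\langle\alpha,\tau\rangle\in\sigma$; binds $\alpha$ to $\tau'$ if $\alpha$ is not bound by $\sigma$ and $\langle\alpha,\tau'\rangle\in\sigma'$; and leaves $\alpha$ unbound otherwise. Satisfaction: $\sigma\models(\tau_1\stackrel{\rm e}{=}\tau_2)$ means $\sigma(\tau_1)=\sigma(\tau_2)$; $\sigma\models C$ means $\sigma$ satisfies every constraint in $C$. Unification: $\mathsf{unify}$ takes a constraint list and either fails ($\mathsf{None}$) or succeeds with a substitution ($\mathsf{Some}\;\sigma$); "$\mathsf{unify}(C)=\sigma$" means that it succeeds with result exactly $\sigma$. It is defined by (with $\tau$ a non-variable type in the third and fourth clauses, and failure of a recursive call propagating): (1) $\mathsf{unify}([\,]) = \sigma_{\mathbb{E}}$; (2) $\mathsf{unify}((\alpha\stackrel{\rm e}{=}\beta)::C) = \mathsf{unify}(C)$ if $\alpha=\beta$, else $\{\alpha\mapsto\beta\}\circ\mathsf{unify}(\{\alpha\mapsto\beta\}(C))$; (3) $\mathsf{unify}((\alpha\stackrel{\rm e}{=}\tau)::C)$ fails if $\alpha$ occurs in $\tau$, else is $\{\alpha\mapsto\tau\}\circ\mathsf{unify}(\{\alpha\mapsto\tau\}(C))$; (4) $\mathsf{unify}((\tau\stackrel{\rm e}{=}\alpha)::C)$ fails if $\alpha$ occurs in $\tau$, else is $\{\alpha\mapsto\tau\}\circ\mathsf{unify}(\{\alpha\mapsto\tau\}(C))$;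 (5) $\mathsf{unify}((\tau_1\rightarrow\tau_2\stackrel{\rm e}{=}\tau_3\rightarrow\tau_4)::C) = \mathsf{unify}((\tau_1\stackrel{\rm e}{=}\tau_3)::(\tau_2\stackrel{\rm e}{=}\tau_4)::C)$. This is a total function by well-founded recursion on the lexicographically ordered triple (number of distinct variables in the list, total number of arrows in the list, length of the list). -}

module Defs where

open import Data.Bool.Base using (if_then_else_)
open import Data.List.Base using (List; []; _∷_; [_]; _++_; map; concatMap; length; deduplicate)
open import Data.List.Membership.Propositional using (_∈_; _∉_)
open import Data.List.Membership.Propositional.Properties
  using (∈-++⁺ˡ; ∈-++⁺ʳ; ∈-++⁻; ∈-insert; ∈-∃++; ∈-deduplicate⁺; ∈-deduplicate⁻)
open import Data.List.Properties using (length-++)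
open import Data.List.Relation.Binary.Subset.Propositional using (_⊆_)
open import Data.List.Relation.Unary.All as All using (All)
open import Data.List.Relation.Unary.All.Properties using (¬Any⇒All¬)
open import Data.List.Relation.Unary.Any using (here; there)
open import Data.List.Relation.Unary.AllPairs using ([]; _∷_)
open import Data.List.Relation.Unary.Unique.Propositional using (Unique)
open import Data.Maybe.Base as Maybe using (Maybe; just; nothing; fromMaybe; _<∣>_)
open import Data.Nat.Base using (ℕ; suc; _+_; _≤_; _<_; z≤n; s≤s)
open import Data.Nat.ListAction using (sum)
open import Data.Nat.Induction using (<-wellFounded)
open import Data.Nat.Properties
  using (module ≤-Reasoning; m≤n⇒m<n∨m≡n; n<1+n; +-suc; +-assoc; +-monoˡ-<; +-mono-<;
         +-commutativeSemigroup)
open import Data.Product.Base using (_×_; _,_; ∃; proj₁; proj₂)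
open import Data.Product.Relation.Binary.Lex.Strict using (×-Lex; ×-wellFounded)
open import Data.Sum.Base using (inj₁; inj₂; [_,_]′)
open import Function.Base using (_∘′_; _on_)
open import Induction.WellFounded using (Acc; acc; WellFounded; module Subrelation)
open import Level using (Level)
open import Relation.Binary.Core using (Rel)
open import Relation.Binary.Definitions using (DecidableEquality)
open import Relation.Binary.PropositionalEquality
  using (_≡_; _≢_; _≗_; refl; sym; cong)
import Relation.Binary.Construct.On as On
open import Relation.Nullary using (yes; no; does; contradiction)
import Data.List.Membership.DecPropositional as DecMembership
open import Data.List.Relation.Unary.Unique.DecPropositional.Properties using (deduplicate-!)

module Unification {a : Level} {TyVar : Set a} (_≟_ : DecidableEquality TyVar) where

  open DecMembership _≟_ using (_∈?_)

  infixr 6 _⇒_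
  infix  5 _≐_

  data Ty : Set a where
    var : TyVar → Ty
    _⇒_ : Ty → Ty → Ty

  data Constraint : Set a where
    _≐_ : Ty → Ty → Constraint

  FTV : Ty → List TyVar
  FTV (var α)   = [ α ]
  FTV (τ₁ ⇒ τ₂) = FTV τ₁ ++ FTV τ₂

  -- A partial function together with a finite list covering its domain.
  -- The list may contain unbound or repeated variables, so equality of
  -- finite maps is _≃_ below rather than _≡_.
  record Subst : Set a where
    constructor mkSubst
    field
      lookup : TyVar → Maybe Ty
      finite : ∃ λ (αs : List TyVar) → ∀ {α τ} → lookup α ≡ just τ → α ∈ αs

  open Subst public

  infix 4 _≃_ _≈_ _⊨ᶜ_ _⊨_
  infixr 9 _∘_

  -- Same bindings. This is finer than _≈_: binding α to var α and leaving
  -- α unbound are distinguished.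
  _≃_ : Rel Subst a
  σ ≃ σ′ = lookup σ ≗ lookup σ′

  apply : Subst → Ty → Ty
  apply σ (var α)   = fromMaybe (var α) (lookup σ α)
  apply σ (τ₁ ⇒ τ₂) = apply σ τ₁ ⇒ apply σ τ₂

  applyᶜ : Subst → Constraint → Constraint
  applyᶜ σ (τ ≐ τ′) = apply σ τ ≐ apply σ τ′

  applyᴸ : Subst → List Constraint → List Constraint
  applyᴸ σ = map (applyᶜ σ)

  _≈_ : Rel Subst a
  σ ≈ σ′ = ∀ α → apply σ (var α) ≡ apply σ′ (var α)

  σ∅ : Subst
  σ∅ = mkSubst (λ _ → nothing) ([] , λ ())

  ⟨_↦_⟩ : TyVar → Ty → Subst
  ⟨ α ↦ τ ⟩ = mkSubst bind ([ α ] , bound)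
    where
    bind : TyVar → Maybe Ty
    bind β = if does (α ≟ β) then just τ else nothing

    bound : ∀ {β τ′} → bind β ≡ just τ′ → β ∈ [ α ]
    bound {β} eq with α ≟ β
    bound {β} eq | yes α≡β = here (sym α≡β)

  -- Diagrammatic order: the left argument acts first.
  _∘_ : Subst → Subst → Subst
  σ ∘ σ′ = mkSubst comp (proj₁ (finite σ) ++ proj₁ (finite σ′) , bound)
    where
    comp : TyVar → Maybe Ty
    comp α = Maybe.map (apply σ′) (lookup σ α) <∣> lookup σ′ α

    bound : ∀ {α τ} → comp α ≡ just τ → α ∈ proj₁ (finite σ) ++ proj₁ (finite σ′)
    bound {α} eq with lookup σ α in eqσ
    ... | just _  = ∈-++⁺ˡ (proj₂ (finite σ) eqσ)
    ... | nothing = ∈-++⁺ʳ (proj₁ (finite σ)) (proj₂ (finite σ′) eq)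

  _⊨ᶜ_ : Subst → Constraint → Set a
  σ ⊨ᶜ (τ₁ ≐ τ₂) = apply σ τ₁ ≡ apply σ τ₂

  _⊨_ : Subst → List Constraint → Set a
  σ ⊨ C = All (σ ⊨ᶜ_) C

  FTVᶜ : Constraint → List TyVar
  FTVᶜ (τ ≐ τ′) = FTV τ ++ FTV τ′

  FTVᴸ : List Constraint → List TyVar
  FTVᴸ = concatMap FTVᶜ

  arrows : Ty → ℕ
  arrows (var _)   = 0
  arrows (τ₁ ⇒ τ₂) = suc (arrows τ₁ + arrows τ₂)

  arrowsᶜ : Constraint → ℕ
  arrowsᶜ (τ ≐ τ′) = arrows τ + arrows τ′

  arrowsᴸ : List Constraint → ℕ
  arrowsᴸ = sum ∘′ map arrowsᶜ

  distinct : List TyVar → ℕ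
  distinct αs = length (deduplicate _≟_ αs)

  measure : List Constraint → ℕ × ℕ × ℕ
  measure C = distinct (FTVᴸ C) , arrowsᴸ C , length C

  infix 4 _≺_

  -- A record, so that `with α ≟ β` does not reach inside the measures.
  record _≺_ (C D : List Constraint) : Set where
    constructor lex
    field
      decreases : (×-Lex _≡_ _<_ (×-Lex _≡_ _<_ _<_) on measure) C D

  ≺-wellFounded : WellFounded _≺_
  ≺-wellFounded =
    Subrelation.wellFounded _≺_.decreases
      (On.wellFounded measure
        (×-wellFounded <-wellFounded (×-wellFounded <-wellFounded <-wellFounded)))

  unique-⊆⇒length≤ : ∀ {αs βs : List TyVar} → Unique αs → αs ⊆ βs → length αs ≤ length βs
  unique-⊆⇒length≤ []          _  = z≤n
  unique-⊆⇒length≤ {α ∷ αs} (α∉ ∷ αs!) ⊆βs with ∈-∃++ (⊆βs (here refl))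
  ... | γs , δs , refl = begin
    suc (length αs)               ≤⟨ s≤s (unique-⊆⇒length≤ αs! rest) ⟩
    suc (length (γs ++ δs))       ≡⟨ cong suc (length-++ γs) ⟩
    suc (length γs + length δs)   ≡⟨ +-suc (length γs) (length δs) ⟨
    length γs + suc (length δs)   ≡⟨ length-++ γs ⟨
    length (γs ++ α ∷ δs)         ∎
    where
    open ≤-Reasoning
    rest : αs ⊆ γs ++ δs
    rest β∈αs with ∈-++⁻ γs (⊆βs (there β∈αs))
    ... | inj₁ β∈γs         = ∈-++⁺ˡ β∈γs
    ... | inj₂ (here β≡α)   = contradiction (sym β≡α) (All.lookup α∉ β∈αs)
    ... | inj₂ (there β∈δs) = ∈-++⁺ʳ γs β∈δs

  distinct-mono-≤ : ∀ {αs βs} → αs ⊆ βs → distinct αs ≤ distinct βs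
  distinct-mono-≤ {αs} αs⊆βs =
    unique-⊆⇒length≤ (deduplicate-! _≟_ αs)
      (λ p → ∈-deduplicate⁺ _≟_ (αs⊆βs (∈-deduplicate⁻ _≟_ αs p)))

  distinct-mono-< : ∀ {αs βs β} → αs ⊆ βs → β ∈ βs → β ∉ αs → distinct αs < distinct βs
  distinct-mono-< {αs} {βs} {β} αs⊆βs β∈βs β∉αs =
    unique-⊆⇒length≤
      (¬Any⇒All¬ _ (λ p → β∉αs (∈-deduplicate⁻ _≟_ αs p)) ∷ deduplicate-! _≟_ αs)
      ⊆βs
    where
    ⊆βs : β ∷ deduplicate _≟_ αs ⊆ deduplicate _≟_ βs
    ⊆βs (here refl) = ∈-deduplicate⁺ _≟_ β∈βs
    ⊆βs (there p)   = ∈-deduplicate⁺ _≟_ (αs⊆βs (∈-deduplicate⁻ _≟_ αs p))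

  ≺-arrows : ∀ {C D} → FTVᴸ C ⊆ FTVᴸ D → arrowsᴸ C < arrowsᴸ D → C ≺ D
  ≺-arrows vs as with m≤n⇒m<n∨m≡n (distinct-mono-≤ vs)
  ... | inj₁ lt = lex (inj₁ lt)
  ... | inj₂ eq = lex (inj₂ (eq , inj₁ as))

  ≺-tail : ∀ α β C → C ≺ (var α ≐ var β) ∷ C
  ≺-tail α β C with m≤n⇒m<n∨m≡n (distinct-mono-≤ (∈-++⁺ʳ (α ∷ β ∷ []) {FTVᴸ C}))
  ... | inj₁ lt = lex (inj₁ lt)
  ... | inj₂ eq = lex (inj₂ (eq , inj₂ (refl , n<1+n (length C))))

  FTV-subst : ∀ α τ → α ∉ FTV τ → ∀ ρ {β} → β ∈ FTV (apply ⟨ α ↦ τ ⟩ ρ) →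
              β ∈ FTV τ ++ FTV ρ × β ≢ α
  FTV-subst α τ α∉τ (var γ) β∈ with α ≟ γ
  ... | yes _  = ∈-++⁺ˡ β∈ , λ { refl → α∉τ β∈ }
  FTV-subst α τ α∉τ (var γ) (here refl) | no α≢γ =
    ∈-++⁺ʳ (FTV τ) (here refl) , λ γ≡α → α≢γ (sym γ≡α)
  FTV-subst α τ α∉τ (ρ₁ ⇒ ρ₂) β∈ with ∈-++⁻ (FTV (apply ⟨ α ↦ τ ⟩ ρ₁)) β∈
  ... | inj₁ p with FTV-subst α τ α∉τ ρ₁ p
  ...   | q , β≢α = [ ∈-++⁺ˡ , (λ r → ∈-++⁺ʳ (FTV τ) (∈-++⁺ˡ r)) ]′ (∈-++⁻ (FTV τ) q) , β≢α
  FTV-subst α τ α∉τ (ρ₁ ⇒ ρ₂) β∈ | inj₂ p with FTV-subst α τ α∉τ ρ₂ p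
  ...   | q , β≢α =
    [ ∈-++⁺ˡ , (λ r → ∈-++⁺ʳ (FTV τ) (∈-++⁺ʳ (FTV ρ₁) r)) ]′ (∈-++⁻ (FTV τ) q) , β≢α

  FTVᴸ-subst : ∀ α τ → α ∉ FTV τ → ∀ C {β} → β ∈ FTVᴸ (applyᴸ ⟨ α ↦ τ ⟩ C) →
               β ∈ FTV τ ++ FTVᴸ C × β ≢ α
  -- A constraint ρ ≐ ρ′ has the same variables as the type ρ ⇒ ρ′.
  FTVᴸ-subst α τ α∉τ ((ρ ≐ ρ′) ∷ C) β∈
    with ∈-++⁻ (FTVᶜ (applyᶜ ⟨ α ↦ τ ⟩ (ρ ≐ ρ′))) β∈
  ... | inj₁ p with FTV-subst α τ α∉τ (ρ ⇒ ρ′) p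
  ...   | q , β≢α = [ ∈-++⁺ˡ , (λ r → ∈-++⁺ʳ (FTV τ) (∈-++⁺ˡ r)) ]′ (∈-++⁻ (FTV τ) q) , β≢α
  FTVᴸ-subst α τ α∉τ ((ρ ≐ ρ′) ∷ C) β∈ | inj₂ p with FTVᴸ-subst α τ α∉τ C p
  ...   | q , β≢α =
    [ ∈-++⁺ˡ , (λ r → ∈-++⁺ʳ (FTV τ) (∈-++⁺ʳ (FTVᶜ (ρ ≐ ρ′)) r)) ]′ (∈-++⁻ (FTV τ) q) , β≢α

  ≢⇒∉FTV : ∀ {α β} → α ≢ β → α ∉ FTV (var β)
  ≢⇒∉FTV α≢β (here α≡β) = α≢β α≡β

  ≺-substˡ : ∀ α τ C → α ∉ FTV τ → applyᴸ ⟨ α ↦ τ ⟩ C ≺ (var α ≐ τ) ∷ C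
  ≺-substˡ α τ C α∉τ = lex (inj₁ (distinct-mono-< {FTVᴸ (applyᴸ ⟨ α ↦ τ ⟩ C)}
    (λ p → there (proj₁ (FTVᴸ-subst α τ α∉τ C p)))
    (here refl)
    (λ p → proj₂ (FTVᴸ-subst α τ α∉τ C p) refl)))

  ≺-substʳ : ∀ α τ C → α ∉ FTV τ → applyᴸ ⟨ α ↦ τ ⟩ C ≺ (τ ≐ var α) ∷ C
  ≺-substʳ α τ C α∉τ = lex (inj₁ (distinct-mono-< {FTVᴸ (applyᴸ ⟨ α ↦ τ ⟩ C)}
    (λ p → [ (λ q → ∈-++⁺ˡ (∈-++⁺ˡ q)) , ∈-++⁺ʳ (FTV τ ++ [ α ]) ]′
             (∈-++⁻ (FTV τ) (proj₁ (FTVᴸ-subst α τ α∉τ C p))))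
    (∈-++⁺ˡ (∈-++⁺ʳ (FTV τ) (here refl)))
    (λ p → proj₂ (FTVᴸ-subst α τ α∉τ C p) refl)))

  ≺-decompose : ∀ τ₁ τ₂ τ₃ τ₄ C →
                (τ₁ ≐ τ₃) ∷ (τ₂ ≐ τ₄) ∷ C ≺ (τ₁ ⇒ τ₂ ≐ τ₃ ⇒ τ₄) ∷ C
  ≺-decompose τ₁ τ₂ τ₃ τ₄ C = ≺-arrows vars count
    where
    A = FTV τ₁ ++ FTV τ₂
    B = FTV τ₃ ++ FTV τ₄

    vars : FTVᴸ ((τ₁ ≐ τ₃) ∷ (τ₂ ≐ τ₄) ∷ C) ⊆ (A ++ B) ++ FTVᴸ C
    vars p with ∈-++⁻ (FTV τ₁ ++ FTV τ₃) p
    ... | inj₁ q = ∈-++⁺ˡ ([ (λ r → ∈-++⁺ˡ (∈-++⁺ˡ r)) , (λ r → ∈-++⁺ʳ A (∈-++⁺ˡ r)) ]′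
                             (∈-++⁻ (FTV τ₁) q))
    ... | inj₂ q with ∈-++⁻ (FTV τ₂ ++ FTV τ₄) q
    ...   | inj₂ r = ∈-++⁺ʳ (A ++ B) r
    ...   | inj₁ r = ∈-++⁺ˡ ([ (λ s → ∈-++⁺ˡ (∈-++⁺ʳ (FTV τ₁) s))
                             , (λ s → ∈-++⁺ʳ A (∈-++⁺ʳ (FTV τ₃) s)) ]′
                               (∈-++⁻ (FTV τ₂) r))

    a₁ = arrows τ₁
    a₂ = arrows τ₂
    a₃ = arrows τ₃
    a₄ = arrows τ₄
    c  = arrowsᴸ C

    count : (a₁ + a₃) + ((a₂ + a₄) + c) < (suc (a₁ + a₂) + suc (a₃ + a₄)) + c
    count = begin-strict
      (a₁ + a₃) + ((a₂ + a₄) + c)             ≡⟨ +-assoc (a₁ + a₃) (a₂ + a₄) c ⟨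
      ((a₁ + a₃) + (a₂ + a₄)) + c             ≡⟨ cong (_+ c) (+-interchange a₁ a₃ a₂ a₄) ⟩
      ((a₁ + a₂) + (a₃ + a₄)) + c             <⟨ +-monoˡ-< c (+-mono-< (n<1+n (a₁ + a₂)) (n<1+n (a₃ + a₄))) ⟩
      (suc (a₁ + a₂) + suc (a₃ + a₄)) + c     ∎
      where
      open ≤-Reasoning
      open import Algebra.Properties.CommutativeSemigroup +-commutativeSemigroup
        using () renaming (interchange to +-interchange)

  unifyAcc : ∀ C → Acc _≺_ C → Maybe Subst
  unifyAcc [] _ = just σ∅
  unifyAcc ((var α ≐ var β) ∷ C) (acc rs) with α ≟ β
  ... | yes _   = unifyAcc C (rs (≺-tail α β C))
  ... | no α≢β  = Maybe.map (⟨ α ↦ var β ⟩ ∘_)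
                    (unifyAcc (applyᴸ ⟨ α ↦ var β ⟩ C)
                      (rs (≺-substˡ α (var β) C (≢⇒∉FTV α≢β))))
  unifyAcc ((var α ≐ τ@(_ ⇒ _)) ∷ C) (acc rs) with α ∈? FTV τ
  ... | yes _   = nothing
  ... | no α∉τ  = Maybe.map (⟨ α ↦ τ ⟩ ∘_)
                    (unifyAcc (applyᴸ ⟨ α ↦ τ ⟩ C) (rs (≺-substˡ α τ C α∉τ)))
  unifyAcc ((τ@(_ ⇒ _) ≐ var α) ∷ C) (acc rs) with α ∈? FTV τ
  ... | yes _   = nothing
  ... | no α∉τ  = Maybe.map (⟨ α ↦ τ ⟩ ∘_)
                    (unifyAcc (applyᴸ ⟨ α ↦ τ ⟩ C) (rs (≺-substʳ α τ C α∉τ)))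
  unifyAcc ((τ₁ ⇒ τ₂ ≐ τ₃ ⇒ τ₄) ∷ C) (acc rs) =
    unifyAcc ((τ₁ ≐ τ₃) ∷ (τ₂ ≐ τ₄) ∷ C) (rs (≺-decompose τ₁ τ₂ τ₃ τ₄ C))

  unify : List Constraint → Maybe Subst
  unify C = unifyAcc C (≺-wellFounded C)

{-# OPTIONS --safe #-}
-- Every solution σ′ of C is absorbed by a unifier σ of C computed by unify: applying σ
-- first and then σ′ is the same as applying σ′. So σ′ itself is the required factor σ″.
-- This passes through the recursion because a solution of α ≐ τ is absorbed by ⟨ α ↦ τ ⟩.
module Submission where

open import Defs
open import Data.List.Base using (List; []; _∷_)
open import Data.List.Relation.Unary.All using ([]; _∷_)
import Data.List.Relation.Unary.All as List
open import Data.List.Relation.Unary.All.Properties using (map⁺)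
open import Data.Maybe.Base using (just; nothing)
import Data.Maybe.Relation.Unary.All as Maybe
open import Data.Maybe.Relation.Binary.Pointwise using (Pointwise; just)
open import Data.Product.Base using (∃-syntax; _,_)
open import Induction.WellFounded using (Acc; acc)
open import Level using (Level)
open import Relation.Binary.Definitions using (DecidableEquality)
open import Relation.Binary.PropositionalEquality using (_≡_; refl; sym; trans; cong₂)
open import Relation.Nullary using (yes; no)
import Data.List.Membership.DecPropositional as DecMembership
import Data.Maybe.Relation.Unary.All.Properties as Maybe

module _ {a : Level} {TyVar : Set a} (_≟_ : DecidableEquality TyVar) where
  open Unification _≟_
  open DecMembership _≟_ using (_∈?_)

  apply-cong : ∀ {σ σ′} → σ ≈ σ′ → ∀ ρ → apply σ ρ ≡ apply σ′ ρ
  apply-cong σ≈σ′ (var α)   = σ≈σ′ α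
  apply-cong σ≈σ′ (ρ₁ ⇒ ρ₂) = cong₂ _⇒_ (apply-cong σ≈σ′ ρ₁) (apply-cong σ≈σ′ ρ₂)

  apply-∘ : ∀ σ σ′ ρ → apply (σ ∘ σ′) ρ ≡ apply σ′ (apply σ ρ)
  apply-∘ σ σ′ (var α) with lookup σ α
  ... | just _  = refl
  -- With `α` unbound in `σ`, `_<∣>_` falls through to `lookup σ′ α`, with `var α` as default on
  -- both sides.
  ... | nothing = refl
  apply-∘ σ σ′ (ρ₁ ⇒ ρ₂) = cong₂ _⇒_ (apply-∘ σ σ′ ρ₁) (apply-∘ σ σ′ ρ₂)

  -- Quantifying over types rather than variables lets `absorbs-∘` instantiate the property at
  -- `apply σ₁ ρ`.
  Absorbs : Subst → Subst → Set a
  Absorbs σ′ σ = ∀ ρ → apply σ′ (apply σ ρ) ≡ apply σ′ ρ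

  absorbs-∅ : ∀ σ′ → Absorbs σ′ σ∅
  absorbs-∅ σ′ (var α)   = refl
  absorbs-∅ σ′ (ρ₁ ⇒ ρ₂) = cong₂ _⇒_ (absorbs-∅ σ′ ρ₁) (absorbs-∅ σ′ ρ₂)

  -- Only `α` is moved, and there the claim is the solved equation reversed.
  absorbs-↦ : ∀ {σ′ α τ} → σ′ ⊨ᶜ (var α ≐ τ) → Absorbs σ′ ⟨ α ↦ τ ⟩
  absorbs-↦ {α = α} eq (var β) with α ≟ β
  ... | yes refl = sym eq
  ... | no _     = refl
  absorbs-↦ eq (ρ₁ ⇒ ρ₂) = cong₂ _⇒_ (absorbs-↦ eq ρ₁) (absorbs-↦ eq ρ₂)

  absorbs-∘ : ∀ {σ′ σ₁ σ₂} → Absorbs σ′ σ₁ → Absorbs σ′ σ₂ → Absorbs σ′ (σ₁ ∘ σ₂)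
  absorbs-∘ {σ′} {σ₁} {σ₂} abs₁ abs₂ ρ
    rewrite apply-∘ σ₁ σ₂ ρ = trans (abs₂ (apply σ₁ ρ)) (abs₁ ρ)

  absorbs-⊨ᶜ : ∀ {σ′ σ} → Absorbs σ′ σ → ∀ {c} → σ′ ⊨ᶜ c → σ′ ⊨ᶜ applyᶜ σ c
  absorbs-⊨ᶜ abs {ρ ≐ ρ′} eq = trans (abs ρ) (trans eq (sym (abs ρ′)))

  -- Keeps `σ′` a solution of the substituted list on which `unifyAcc` recurses.
  absorbs-⊨ : ∀ {σ′ σ C} → Absorbs σ′ σ → σ′ ⊨ C → σ′ ⊨ applyᴸ σ C
  absorbs-⊨ {σ = σ} abs sat = map⁺ (List.map (absorbs-⊨ᶜ {σ = σ} abs) sat)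

  ⇒-injective : ∀ {τ₁ τ₂ τ₃ τ₄ C σ} → σ ⊨ (τ₁ ⇒ τ₂ ≐ τ₃ ⇒ τ₄) ∷ C →
                σ ⊨ (τ₁ ≐ τ₃) ∷ (τ₂ ≐ τ₄) ∷ C
  ⇒-injective (eq ∷ sat) = injˡ eq ∷ injʳ eq ∷ sat
    where
    injˡ : ∀ {τ₁ τ₂ τ₃ τ₄} → τ₁ ⇒ τ₂ ≡ τ₃ ⇒ τ₄ → τ₁ ≡ τ₃
    injˡ refl = refl
    injʳ : ∀ {τ₁ τ₂ τ₃ τ₄} → τ₁ ⇒ τ₂ ≡ τ₃ ⇒ τ₄ → τ₂ ≡ τ₄
    injʳ refl = refl

  -- The accessibility proof is arbitrary so that the induction applies to every recursive call;
  -- `Maybe.All` makes failure vacuous.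
  unifyAcc-absorbed : ∀ {σ′} C (ac : Acc _≺_ C) → σ′ ⊨ C →
                      Maybe.All (Absorbs σ′) (unifyAcc C ac)

  -- Shared by the three cases that bind a variable. Here `ac` is passed on unchanged; the mutual
  -- recursion descends where the callers supply `rs _`.
  eliminate : ∀ {σ′} α τ C (ac : Acc _≺_ (applyᴸ ⟨ α ↦ τ ⟩ C)) →
              σ′ ⊨ᶜ (var α ≐ τ) → σ′ ⊨ C →
              Maybe.All (λ σ → Absorbs σ′ (⟨ α ↦ τ ⟩ ∘ σ)) (unifyAcc (applyᴸ ⟨ α ↦ τ ⟩ C) ac)
  eliminate α τ C ac eq sat =
    Maybe.map (λ {σ} → absorbs-∘ {σ₂ = σ} (absorbs-↦ eq))
      (unifyAcc-absorbed (applyᴸ ⟨ α ↦ τ ⟩ C) ac (absorbs-⊨ {σ = ⟨ α ↦ τ ⟩} (absorbs-↦ eq) sat))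

  unifyAcc-absorbed [] _ _ = Maybe.just (absorbs-∅ _)
  unifyAcc-absorbed ((var α ≐ var β) ∷ C) (acc rs) (eq ∷ sat) with α ≟ β
  ... | yes _ = unifyAcc-absorbed C _ sat
  ... | no _  = Maybe.map⁺ (eliminate α (var β) C (rs _) eq sat)
  unifyAcc-absorbed ((var α ≐ τ@(_ ⇒ _)) ∷ C) (acc rs) (eq ∷ sat) with α ∈? FTV τ
  ... | yes _ = Maybe.nothing
  ... | no _  = Maybe.map⁺ (eliminate α τ C (rs _) eq sat)
  unifyAcc-absorbed ((τ@(_ ⇒ _) ≐ var α) ∷ C) (acc rs) (eq ∷ sat) with α ∈? FTV τ
  ... | yes _ = Maybe.nothing
  -- The variable is on the right of the constraint, but the binding is still `α ↦ τ`.
  ... | no _  = Maybe.map⁺ (eliminate α τ C (rs _) (sym eq) sat)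
  unifyAcc-absorbed ((τ₁ ⇒ τ₂ ≐ τ₃ ⇒ τ₄) ∷ C) (acc rs) sat =
    unifyAcc-absorbed ((τ₁ ≐ τ₃) ∷ (τ₂ ≐ τ₄) ∷ C) (rs _) (⇒-injective sat)

  ≃⇒≈ : ∀ {σ₁ σ₂} → σ₁ ≃ σ₂ → σ₁ ≈ σ₂
  ≃⇒≈ σ₁≃σ₂ α rewrite σ₁≃σ₂ α = refl

  -- Needed because the result of `unify` is given only up to `_≃_`: the lists in `finite` may
  -- differ, but `apply` consults only `lookup`.
  absorbs-resp-≃ : ∀ {σ′ σ₁ σ₂} → σ₁ ≃ σ₂ → Absorbs σ′ σ₁ → Absorbs σ′ σ₂
  absorbs-resp-≃ {σ₁ = σ₁} {σ₂} σ₁≃σ₂ abs ρ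
    rewrite sym (apply-cong {σ₁} {σ₂} (≃⇒≈ {σ₁} {σ₂} σ₁≃σ₂) ρ) = abs ρ

  absorbs-result : ∀ {σ′ σ m} → Maybe.All (Absorbs σ′) m → Pointwise _≃_ m (just σ) → Absorbs σ′ σ
  absorbs-result {σ = σ} (Maybe.just {x = σ₁} abs) (just σ₁≃σ) =
    absorbs-resp-≃ {σ₁ = σ₁} {σ} σ₁≃σ abs

theorem3 : {a : Level} {TyVar : Set a} (_≟_ : DecidableEquality TyVar) →
    let open Unification _≟_ in
    (C : List Constraint) (σ σ′ : Subst) →
    Pointwise _≃_ (unify C) (just σ) →
    σ′ ⊨ C →
    ∃[ σ″ ] (σ′ ≈ (σ ∘ σ″))
theorem3 _≟_ C σ σ′ unifies sat = σ′ , λ α →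
  -- Absorption at `var α`, once the composite is split into two applications.
  sym (trans (apply-∘ _≟_ σ σ′ (var α)) (absorbed (var α)))
  where
  open Unification _≟_
  absorbed : Absorbs _≟_ σ′ σ
  absorbed = absorbs-result _≟_ (unifyAcc-absorbed _≟_ C (≺-wellFounded C) sat) unifies
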